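{- $R(K_4, K_4-e, K_4-e) \ge 35$. Equivalently, there exists a $3$-coloring of the edges of $K_{34}$ with colors $1,2,3$ that contains no copy of $K_4$ all of whose edges have color $1$, no copy of $K_4-e$ all of whose edges have color $2$, and no copy of $K_4-e$ all of whose edges have color $3$.
   Context: For graphs $G_1,\dots,G_k$, the multicolor Ramsey number $R(G_1,\dots,G_k)$ is the smallest $n$ such that every $k$-coloring of the edges of the complete graph $K_n$ (with colors $1,\dots,k$) contains, for some $i$, a copy of $G_i$ (as a not necessarily induced subgraph) all of whose edges have color $i$. $K_4-e$ denotes the graph obtained from $K_4$ by deleting one edge. -}

module Defs where

open import Data.Nat using (ℕ)
open import Data.Fin using (Fin; zero; suc)
open import Data.Product using (Σ; _×_; _,_)
open import Relation.Binary.PropositionalEquality using (_≡_; _≢_)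
open import Relation.Nullary using (¬_)
open import Function.Definitions using (Injective)

Graph : ℕ → Set₁
Graph k = Fin k → Fin k → Set

K4 : Graph 4
K4 a b = a ≢ b

K4-e : Graph 4
K4-e a b = (a ≢ b) × ¬ (a ≡ zero × b ≡ suc zero) × ¬ (a ≡ suc zero × b ≡ zero)

Colour : Set
Colour = Fin 3

col1 col2 col3 : Colour
col1 = zero
col2 = suc zero
col3 = suc (suc zero)

-- An edge colouring of K_n with 3 colours: a symmetric function on pairs
-- (the value on the diagonal is irrelevant, it is never used for edges).
record EdgeColouring (n : ℕ) : Set where
  field
    colour : Fin n → Fin n → Colour
    symm   : ∀ i j → colour i j ≡ colour j i
open EdgeColouring public

MonoCopy : ∀ {n k} → EdgeColouring n → Graph k → Colour → Set
MonoCopy {n} {k} c G κ =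
  Σ (Fin k → Fin n) λ f →
    Injective _≡_ _≡_ f × (∀ a b → G a b → colour c (f a) (f b) ≡ κ)

{-# OPTIONS --safe #-}
-- The colouring is invariant under a permutation of the 34 vertices with
-- cycles of lengths 8, 8, 8, 8 and 2; it was found by tabu search among the
-- colourings with that symmetry. Vertex 8p + x is the x-th point of cycle p,
-- so the colour of an edge depends only on the two cycles and on the
-- difference of positions modulo 8. That no forbidden subgraph occurs is
-- decided by exhaustive search, abandoning a partial copy as soon as one of
-- its edges has the wrong colour.
module Submission where

open import Defs
open import Data.Nat using (_+_; _∸_; _/_; _%_)
open import Data.Nat.DivMod using (_mod_)
open import Data.Fin using (Fin; toℕ; _≟_; #_)
open import Data.Fin.Properties using (all?)
open import Data.Product using (Σ; _×_; _,_)
open import Data.Vec using (Vec; []; _∷_; lookup)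
open import Function using (_∘_)
open import Relation.Binary.PropositionalEquality using (_≡_; _≢_)
open import Relation.Nullary using (¬_; Dec)
open import Relation.Nullary.Decidable using (¬?; _×-dec_; _→-dec_; from-yes)

private
  pattern r = Fin.zero
  pattern g = Fin.suc Fin.zero
  pattern b = Fin.suc (Fin.suc Fin.zero)

-- The last cycle has length 2, so the blocks involving it have period 2.
blocks : Vec (Vec (Vec Colour 8) 5) 5
blocks =
  ( (r ∷ b ∷ r ∷ g ∷ g ∷ g ∷ r ∷ b ∷ [])
    ∷ (r ∷ b ∷ g ∷ b ∷ r ∷ r ∷ b ∷ r ∷ [])
    ∷ (b ∷ r ∷ b ∷ r ∷ g ∷ g ∷ g ∷ g ∷ [])
    ∷ (r ∷ r ∷ b ∷ r ∷ b ∷ g ∷ b ∷ g ∷ [])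
    ∷ (g ∷ r ∷ g ∷ r ∷ g ∷ r ∷ g ∷ r ∷ [])
    ∷ [] )
  ∷ ( (r ∷ r ∷ b ∷ r ∷ r ∷ b ∷ g ∷ b ∷ [])
    ∷ (r ∷ b ∷ r ∷ r ∷ b ∷ r ∷ r ∷ b ∷ [])
    ∷ (g ∷ g ∷ r ∷ b ∷ g ∷ b ∷ g ∷ g ∷ [])
    ∷ (b ∷ g ∷ b ∷ r ∷ g ∷ r ∷ g ∷ g ∷ [])
    ∷ (b ∷ r ∷ b ∷ r ∷ b ∷ r ∷ b ∷ r ∷ [])
    ∷ [] )
  ∷ ( (b ∷ g ∷ g ∷ g ∷ g ∷ r ∷ b ∷ r ∷ [])
    ∷ (g ∷ g ∷ g ∷ b ∷ g ∷ b ∷ r ∷ g ∷ [])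
    ∷ (r ∷ r ∷ r ∷ b ∷ b ∷ b ∷ r ∷ r ∷ [])
    ∷ (b ∷ b ∷ r ∷ r ∷ g ∷ r ∷ r ∷ b ∷ [])
    ∷ (b ∷ r ∷ b ∷ r ∷ b ∷ r ∷ b ∷ r ∷ [])
    ∷ [] )
  ∷ ( (r ∷ g ∷ b ∷ g ∷ b ∷ r ∷ b ∷ r ∷ [])
    ∷ (b ∷ g ∷ g ∷ r ∷ g ∷ r ∷ b ∷ g ∷ [])
    ∷ (b ∷ b ∷ r ∷ r ∷ g ∷ r ∷ r ∷ b ∷ [])
    ∷ (r ∷ g ∷ r ∷ b ∷ g ∷ b ∷ r ∷ g ∷ [])
    ∷ (g ∷ r ∷ g ∷ r ∷ g ∷ r ∷ g ∷ r ∷ [])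
    ∷ [] )
  ∷ ( (g ∷ r ∷ g ∷ r ∷ g ∷ r ∷ g ∷ r ∷ [])
    ∷ (b ∷ r ∷ b ∷ r ∷ b ∷ r ∷ b ∷ r ∷ [])
    ∷ (b ∷ r ∷ b ∷ r ∷ b ∷ r ∷ b ∷ r ∷ [])
    ∷ (g ∷ r ∷ g ∷ r ∷ g ∷ r ∷ g ∷ r ∷ [])
    ∷ (r ∷ b ∷ r ∷ b ∷ r ∷ b ∷ r ∷ b ∷ [])
    ∷ [] )
  ∷ []

blockColour : Fin 34 → Fin 34 → Colour
blockColour i j =
  -- The quotients are at most 4, so `mod 5` is only a cast. Adding 8 keeps `∸` from truncating, as
  -- `toℕ i % 8` is at most 7.
  lookup (lookup (lookup blocks ((toℕ i / 8) mod 5)) ((toℕ j / 8) mod 5))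
    ((8 + toℕ j ∸ toℕ i % 8) mod 8)

blockColouring : EdgeColouring 34
blockColouring = record
  { colour = blockColour
  -- Entry d of block (p, q) equals entry -d modulo 8 of block (q, p).
  ; symm   = from-yes (all? λ i → all? λ j → blockColour i j ≟ blockColour j i)
  }

module _ {n} (c : EdgeColouring n) (κ : Colour) where

  -- The diagonal of `blockColour` is all `r`; `u ≢ v` keeps these loops from counting as edges of
  -- colour 1.
  Adj : Fin n → Fin n → Set
  Adj u v = colour c u v ≡ κ × u ≢ v

  adj? : ∀ u v → Dec (Adj u v)
  adj? u v = (colour c u v ≟ κ) ×-dec ¬? (u ≟ v)

  -- u and v are the two vertices of degree 3 in K4-e.
  K4-Free K4-e-Free : Set
  K4-Free   = ∀ u v → Adj u v → ∀ w → Adj u w → Adj v w →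
              ∀ z → Adj u z → Adj v z → ¬ Adj w z
  K4-e-Free = ∀ u v → Adj u v → ∀ w → Adj u w → Adj v w →
              ∀ z → Adj u z → Adj v z → ¬ w ≢ z

  K4-free? : Dec K4-Free
  K4-free? =
    -- A failed premise decides `→-dec` without evaluating the conclusion, which prunes the search.
    all? λ u → all? λ v → adj? u v →-dec
    all? λ w → adj? u w →-dec (adj? v w →-dec
    all? λ z → adj? u z →-dec (adj? v z →-dec ¬? (adj? w z)))

  K4-e-free? : Dec K4-e-Free
  K4-e-free? =
    all? λ u → all? λ v → adj? u v →-dec
    all? λ w → adj? u w →-dec (adj? v w →-dec
    all? λ z → adj? u z →-dec (adj? v z →-dec ¬? (¬? (w ≟ z))))

  K4-Free⇒¬MonoCopy : K4-Free → ¬ MonoCopy c K4 κ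
  K4-Free⇒¬MonoCopy free (f , f-inj , mono) =
    free (f (# 0)) (f (# 1)) (edge (λ ()))
         (f (# 2)) (edge (λ ())) (edge (λ ()))
         (f (# 3)) (edge (λ ())) (edge (λ ())) (edge (λ ()))
    where
    edge : ∀ {i j} → i ≢ j → Adj (f i) (f j)
    edge {i} {j} i≢j = mono i j i≢j , i≢j ∘ f-inj

  K4-e-Free⇒¬MonoCopy : K4-e-Free → ¬ MonoCopy c K4-e κ
  K4-e-Free⇒¬MonoCopy free (f , f-inj , mono) =
    -- The edge missing from `K4-e` joins 0 and 1, so 2 and 3 have degree 3.
    free (f (# 2)) (f (# 3)) (edge ((λ ()) , (λ ()) , (λ ())))
         (f (# 0)) (edge ((λ ()) , (λ ()) , (λ ()))) (edge ((λ ()) , (λ ()) , (λ ())))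
         (f (# 1)) (edge ((λ ()) , (λ ()) , (λ ()))) (edge ((λ ()) , (λ ()) , (λ ())))
         -- The pair 0, 1 may have any colour; injectivity alone separates its images.
         ((λ ()) ∘ f-inj)
    where
    edge : ∀ {i j} → K4-e i j → Adj (f i) (f j)
    edge {i} {j} ij@(i≢j , _) = mono i j ij , i≢j ∘ f-inj

theorem1 : Σ (EdgeColouring 34) λ c →
    ¬ MonoCopy c K4 col1 × ¬ MonoCopy c K4-e col2 × ¬ MonoCopy c K4-e col3
theorem1 =
    blockColouring
  , K4-Free⇒¬MonoCopy blockColouring col1 (from-yes (K4-free? blockColouring col1))
  , K4-e-Free⇒¬MonoCopy blockColouring col2 (from-yes (K4-e-free? blockColouring col2))
  , K4-e-Free⇒¬MonoCopy blockColouring col3 (from-yes (K4-e-free? blockColouring col3))
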